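{- For a finite tree $T$ on $n = |V(T)|$ vertices, let $$s_5(T) = {}^{m}M_2(T) - \frac{n+1}{4},$$ where ${}^{m}M_2(T) = \sum_{uv \in E(T)} \frac{1}{d_u d_v}$ is the modified second Zagreb index of $T$. For each positive integer $k$, let $T_1(k)$ be the tree on $5k$ vertices with vertex set $\bigcup_{i=1}^k \{u_i, v_i, w_i, x_i, y_i\}$ and edge set $\left(\bigcup_{i=1}^k \{u_iv_i, v_iw_i, w_ix_i, x_iy_i\}\right) \cup \{w_1w_2, w_2w_3, \dots, w_{k-1}w_k\}$. Then $$\lim_{k \to \infty} s_5(T_1(k)) = \infty.$$
   Context: Graphs are finite, simple and undirected; $V(G)$ and $E(G)$ denote the vertex and edge sets of $G$, an edge $\{u,v\}$ is written $uv$, and $d_v$ denotes the degree of the vertex $v$ (the number of vertices adjacent to $v$). In the definition of $T_1(k)$ the $5k$ named vertices are pairwise distinct. -}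

module Defs where

open import Data.Empty using (⊥-elim)
open import Data.Fin.Base as Fin using (Fin; zero; suc; toℕ; fromℕ; inject₁)
open import Data.Fin.Patterns using (0F; 1F; 2F; 3F; 4F)
open import Data.Fin.Properties as Fin using (toℕ-injective; toℕ-inject₁; *↔×)
open import Data.Integer.Base using (+_)
open import Data.List.Base using (List; length; filter; map; foldr; tabulate; cartesianProduct)
open import Data.Nat.Base as ℕ using (ℕ; zero; suc; _≤_; NonZero; z≤n; s≤s)
import Data.Nat.Properties as ℕ
open import Data.Product.Base using (∃-syntax; _×_; _,_)
open import Data.Rational.Base as ℚ using (ℚ; 0ℚ; _/_)
open import Data.Sum.Base using (inj₁; inj₂; [_,_])
open import Function.Base using (_∘_)
open import Function.Bundles using (_↔_; Inverse)
open import Function.Definitions using (Injective)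
open import Level using (0ℓ)
open import Relation.Binary.Construct.Closure.ReflexiveTransitive using (Star; ε; _◅_; _◅◅_; reverse)
open import Relation.Binary.Construct.Closure.Symmetric using (SymClosure; fwd; bwd; symmetric)
open import Relation.Binary.Core using (Rel)
open import Relation.Binary.Definitions using (Decidable; Irreflexive; Symmetric)
open import Relation.Binary.PropositionalEquality
  using (_≡_; _≢_; refl; sym; trans; cong; subst)
open import Relation.Nullary.Decidable using (no; _×-dec_; _⊎-dec_; map′)
open import Relation.Nullary.Negation using (¬_)

------------------------------------------------------------------------
-- Finite simple graphs

record Graph : Set₁ where
  infix 4 _~_ _~?_
  field
    V      : Set
    order  : ℕ
    enum   : Fin order ↔ V
    _~_    : Rel V 0ℓ
    _~?_   : Decidable _~_
    ~-sym  : Symmetric _~_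
    ~-irr  : Irreflexive _≡_ _~_

  index : V → Fin order
  index = Inverse.from enum

  vertices : List V
  vertices = tabulate (Inverse.to enum)

  degree : V → ℕ
  degree a = length (filter (a ~?_) vertices)

  -- Each undirected edge is listed once, with its endpoints in
  -- increasing order of index.
  edges : List (V × V)
  edges = filter (λ (a , b) → (index a Fin.<? index b) ×-dec (a ~? b))
                 (cartesianProduct vertices vertices)

------------------------------------------------------------------------
-- Trees

module _ (G : Graph) where
  open Graph G

  Connected : Set
  Connected = ∀ a b → Star _~_ a b

  -- A cycle c₀ ~ c₁ ~ ⋯ ~ c_l ~ c₀ through l + 1 ≥ 3 distinct vertices.
  record Cycle : Set where
    field
      l        : ℕ
      2≤l      : 2 ≤ l
      c        : Fin (suc l) → V
      distinct : Injective _≡_ _≡_ c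
      step     : ∀ (i : Fin l) → c (inject₁ i) ~ c (suc i)
      close    : c (fromℕ l) ~ c zero

  record IsTree : Set where
    field
      nonempty  : NonZero order
      connected : Connected
      acyclic   : ¬ Cycle

record Tree : Set₁ where
  field
    graph  : Graph
    isTree : IsTree graph
  open Graph graph public

------------------------------------------------------------------------
-- The modified second Zagreb index and s₅

-- The value at 0 is never used below: the endpoints of an edge have
-- positive degree.
recip : ℕ → ℚ
recip zero      = 0ℚ
recip d@(suc _) = + 1 / d

sumℚ : List ℚ → ℚ
sumℚ = foldr ℚ._+_ 0ℚ

ᵐM₂ : Graph → ℚ
ᵐM₂ G = sumℚ (map (λ (a , b) → recip (degree a ℕ.* degree b)) edges)
  where open Graph G

s₅ : Tree → ℚ
s₅ T = ᵐM₂ (Tree.graph T) ℚ.- + (Tree.order T ℕ.+ 1) / 4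

------------------------------------------------------------------------
-- The graph underlying T₁ k

-- The index i ∈ {1, …, k} is shifted to Fin k.
T₁-Vertex : ℕ → Set
T₁-Vertex k = Fin k × Fin 5

pattern u i = i , 0F
pattern v i = i , 1F
pattern w i = i , 2F
pattern x i = i , 3F
pattern y i = i , 4F

data T₁-Edge {k : ℕ} : Rel (T₁-Vertex k) 0ℓ where
  uv : ∀ i → T₁-Edge (u i) (v i)
  vw : ∀ i → T₁-Edge (v i) (w i)
  wx : ∀ i → T₁-Edge (w i) (x i)
  xy : ∀ i → T₁-Edge (x i) (y i)
  ww : ∀ i j → toℕ j ≡ suc (toℕ i) → T₁-Edge (w i) (w j)

T₁-edge? : ∀ {k} → Decidable (T₁-Edge {k})
T₁-edge? (u i) (v j) = map′ (λ { refl → uv i }) (λ { (uv _) → refl }) (i Fin.≟ j)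
T₁-edge? (v i) (w j) = map′ (λ { refl → vw i }) (λ { (vw _) → refl }) (i Fin.≟ j)
T₁-edge? (w i) (x j) = map′ (λ { refl → wx i }) (λ { (wx _) → refl }) (i Fin.≟ j)
T₁-edge? (x i) (y j) = map′ (λ { refl → xy i }) (λ { (xy _) → refl }) (i Fin.≟ j)
T₁-edge? (w i) (w j) = map′ (ww i j) (λ { (ww _ _ e) → e }) (toℕ j ℕ.≟ suc (toℕ i))
T₁-edge? (u _) (u _) = no λ ()
T₁-edge? (u _) (w _) = no λ ()
T₁-edge? (u _) (x _) = no λ ()
T₁-edge? (u _) (y _) = no λ ()
T₁-edge? (v _) (u _) = no λ ()
T₁-edge? (v _) (v _) = no λ ()
T₁-edge? (v _) (x _) = no λ ()
T₁-edge? (v _) (y _) = no λ ()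
T₁-edge? (w _) (u _) = no λ ()
T₁-edge? (w _) (v _) = no λ ()
T₁-edge? (w _) (y _) = no λ ()
T₁-edge? (x _) (u _) = no λ ()
T₁-edge? (x _) (v _) = no λ ()
T₁-edge? (x _) (w _) = no λ ()
T₁-edge? (x _) (x _) = no λ ()
T₁-edge? (y _) (u _) = no λ ()
T₁-edge? (y _) (v _) = no λ ()
T₁-edge? (y _) (w _) = no λ ()
T₁-edge? (y _) (x _) = no λ ()
T₁-edge? (y _) (y _) = no λ ()

T₁-edge-irr : ∀ {k} {a : T₁-Vertex k} → ¬ T₁-Edge a a
T₁-edge-irr (ww i _ e) = ℕ.1+n≢n (sym e)

T₁-graph : ℕ → Graph
T₁-graph k = record
  { V     = T₁-Vertex k
  ; order = k ℕ.* 5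
  ; enum  = *↔×
  ; _~_   = SymClosure T₁-Edge
  ; _~?_  = λ a b → map′ [ fwd , bwd ] (λ { (fwd e) → inj₁ e ; (bwd e) → inj₂ e })
                         (T₁-edge? a b ⊎-dec T₁-edge? b a)
  ; ~-sym = symmetric T₁-Edge
  ; ~-irr = λ { refl (fwd e) → T₁-edge-irr e ; refl (bwd e) → T₁-edge-irr e }
  }

------------------------------------------------------------------------
-- T₁ k is a tree

private

  maximum : ∀ {l} (f : Fin (suc l) → ℕ) → ∃[ i ] ∀ j → f j ≤ f i
  maximum {zero}  f = zero , λ { zero → ℕ.≤-refl }
  maximum {suc l} f with maximum (f ∘ suc)
  ... | i , max with ℕ.≤-total (f zero) (f (suc i))
  ...   | inj₁ f0≤fi = suc i , λ { zero → f0≤fi ; (suc j) → max j }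
  ...   | inj₂ fi≤f0 = zero  , λ { zero → ℕ.≤-refl ; (suc j) → ℕ.≤-trans (max j) fi≤f0 }

  data View {l : ℕ} : Fin (suc l) → Set where
    last : View (fromℕ l)
    inj  : (i : Fin l) → View (inject₁ i)

  view : ∀ {l} (i : Fin (suc l)) → View i
  view {zero}  zero    = last
  view {suc l} zero    = inj zero
  view {suc l} (suc i) with view i
  ... | last  = last
  ... | inj j = inj (suc j)

-- At a vertex of maximal rank on a cycle, both neighbours along the
-- cycle would be the parent.
module _ (G : Graph) where
  open Graph G

  ranked⇒acyclic : (rank : V → ℕ) (parent : V → V) →
                   (∀ {a b} → a ~ b → rank a ≤ rank b → a ≡ parent b) →
                   ¬ Cycle G
  ranked⇒acyclic rank parent lower C with C .Cycle.l | C .Cycle.2≤l | C .Cycle.c | C .Cycle.distinct | C .Cycle.step | C .Cycle.close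
  ... | suc (suc l) | s≤s (s≤s _) | c | distinct | step | close
    with maximum (rank ∘ c)
  ... | i , max = go i max
    where
    clash : ∀ i p q → (∀ j → rank (c j) ≤ rank (c i)) → c p ~ c i → c q ~ c i → p ≡ q
    clash i p q max p~i q~i =
      distinct (trans (lower p~i (max p)) (sym (lower q~i (max q))))

    inject₁²≢suc² : ∀ {n} (j : Fin n) → inject₁ (inject₁ j) ≢ suc (suc j)
    inject₁²≢suc² (suc j) e = inject₁²≢suc² j (Fin.suc-injective e)

    go : ∀ i → ¬ (∀ j → rank (c j) ≤ rank (c i))
    go zero max
      with () ← clash zero (suc zero) (fromℕ _) max (~-sym (step zero)) close
    go (suc i) max with view i
    ... | last
      with () ← clash (suc i) (inject₁ i) zero max (step i) (~-sym close)
    ... | inj j =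
      inject₁²≢suc² j (clash (suc i) (inject₁ i) (suc (suc j)) max (step i) (~-sym (step (suc j))))

private

  rank : ∀ {k} → T₁-Vertex k → ℕ
  rank (u i) = 2 ℕ.+ toℕ i
  rank (v i) = 1 ℕ.+ toℕ i
  rank (w i) = toℕ i
  rank (x i) = 1 ℕ.+ toℕ i
  rank (y i) = 2 ℕ.+ toℕ i

  parent : ∀ {k} → T₁-Vertex k → T₁-Vertex k
  parent (u i) = v i
  parent (v i) = w i
  parent (w i) = w (Fin.pred i)
  parent (x i) = w i
  parent (y i) = x i

  pred-unique : ∀ {k} (i j : Fin k) → toℕ j ≡ suc (toℕ i) → i ≡ Fin.pred j
  pred-unique i (suc j) e =
    toℕ-injective (trans (sym (ℕ.suc-injective e)) (sym (toℕ-inject₁ j)))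

  lower : ∀ {k} {a b : T₁-Vertex k} → SymClosure T₁-Edge a b → rank a ≤ rank b → a ≡ parent b
  lower (fwd (uv i))     r = ⊥-elim (ℕ.1+n≰n r)
  lower (fwd (vw i))     r = ⊥-elim (ℕ.1+n≰n r)
  lower (fwd (wx i))     r = refl
  lower (fwd (xy i))     r = refl
  lower (fwd (ww i j e)) r = cong (_, 2F) (pred-unique i j e)
  lower (bwd (uv i))     r = refl
  lower (bwd (vw i))     r = refl
  lower (bwd (wx i))     r = ⊥-elim (ℕ.1+n≰n r)
  lower (bwd (xy i))     r = ⊥-elim (ℕ.1+n≰n r)
  lower (bwd (ww i j e)) r = ⊥-elim (ℕ.1+n≰n (subst (_≤ toℕ i) e r))

  Walk : ∀ {k} → Rel (T₁-Vertex k) 0ℓ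
  Walk = Star (SymClosure T₁-Edge)

  spine : ∀ {k} n (i : Fin (suc k)) → toℕ i ≡ n → Walk (w i) (w zero)
  spine _       zero    _ = ε
  spine (suc n) (suc i) e =
    bwd (ww (inject₁ i) (suc i) (cong suc (sym (toℕ-inject₁ i))))
      ◅ spine n (inject₁ i) (trans (toℕ-inject₁ i) (ℕ.suc-injective e))

  toRoot : ∀ {k} (a : T₁-Vertex (suc k)) → Walk a (w zero)
  toRoot (u i) = fwd (uv i) ◅ fwd (vw i) ◅ spine _ i refl
  toRoot (v i) = fwd (vw i) ◅ spine _ i refl
  toRoot (w i) = spine _ i refl
  toRoot (x i) = bwd (wx i) ◅ spine _ i refl
  toRoot (y i) = bwd (xy i) ◅ bwd (wx i) ◅ spine _ i refl

T₁-isTree : ∀ k → .{{_ : NonZero k}} → IsTree (T₁-graph k)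
T₁-isTree k@(suc _) = record
  { nonempty  = _
  ; connected = λ a b → toRoot a ◅◅ reverse (symmetric T₁-Edge) (toRoot b)
  ; acyclic   = ranked⇒acyclic (T₁-graph k) rank parent lower
  }

T₁ : (k : ℕ) → .{{NonZero k}} → Tree
T₁ k = record { graph = T₁-graph k ; isTree = T₁-isTree k }

{-# OPTIONS --safe #-}
-- The degrees of u, v, w, x, y in T₁ k are at most 1, 2, 4, 2, 1. For each i < k the
-- five edges u_i v_i, v_i w_i, w_i x_i, x_i y_i, w_i w_{i+1} therefore contribute at
-- least 1/2 + 1/8 + 1/8 + 1/2 + 1/16 = 21/16 to ᵐM₂, while the vertices of one block
-- add only 5/4 to (n + 1)/4. Hence s₅ (T₁ (m + 1)) ≥ 21m/16 - (5m + 6)/4 = (m - 24)/16.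
module Submission where

open import Defs
open import Data.Nat.Base using (ℕ; NonZero; _≤_)
open import Data.Product.Base using (∃-syntax)
open import Data.Rational.Base using (ℚ; _<_)

open import Data.Fin.Base as Fin using (Fin; suc; toℕ; inject₁; combine)
open import Data.Fin.Patterns using (0F; 1F; 2F; 3F; 4F)
import Data.Fin.Properties as Fin
open import Data.Integer.Base as ℤ using (+_; -[1+_])
import Data.Integer.Properties as ℤ
open import Data.Integer.Tactic.RingSolver using (solve-∀)
open import Data.List.Base
  using (List; []; _∷_; _++_; length; map; filter; allFin; cartesianProduct)
open import Data.List.Membership.Propositional using (_∈_)
open import Data.List.Membership.Propositional.Properties
  using (∈-∃++; ∈-length; ∈-tabulate⁺; ∈-filter⁺; ∈-filter⁻; ∈-cartesianProduct⁺; ∈-map⁻)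
open import Data.List.Properties using (length-map; length-++; length-tabulate; map-++; map-∘)
open import Data.List.Relation.Binary.Permutation.Propositional
  using (_↭_; ↭-refl; ↭-trans; prep; ↭⇒↭ₛ)
open import Data.List.Relation.Binary.Permutation.Propositional.Properties
  using (shift; ↭-length; ∈-resp-↭)
  renaming (map⁺ to ↭-map⁺)
open import Data.List.Relation.Binary.Permutation.Setoid.Properties using (foldr-commMonoid)
open import Data.List.Relation.Binary.Subset.Propositional using (_⊆_)
import Data.List.Relation.Unary.All as All
open import Data.List.Relation.Unary.AllPairs using (_∷_)
open import Data.List.Relation.Unary.Any using (here; there)
open import Data.List.Relation.Unary.Unique.Propositional using (Unique)
import Data.List.Relation.Unary.Unique.Propositional.Properties as Unique
open import Data.Nat.Base as ℕ using (zero; suc; z≤n; s≤s; z<s)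
import Data.Nat.Properties as ℕ
open import Data.Product.Base using (_×_; _,_; proj₁; proj₂; map₁; uncurry)
open import Data.Rational.Base as ℚ using (0ℚ; _/_; toℚᵘ; fromℚᵘ)
import Data.Rational.Properties as ℚ
open import Data.Rational.Unnormalised.Base as ℚᵘ using (ℚᵘ; mkℚᵘ; *≡*; *≤*; *<*)
import Data.Rational.Unnormalised.Properties as ℚᵘ
open import Function.Base using (_∘_)
open import Function.Bundles using (Inverse)
open import Relation.Binary.Construct.Closure.Symmetric using (fwd; bwd)
open import Relation.Binary.PropositionalEquality
  using (_≡_; refl; sym; trans; cong; cong₂; subst; subst₂; setoid; module ≡-Reasoning)
open import Relation.Nullary.Negation using (contradiction)

-- Duplicate-free sublists

-- The explicit complement `cs` lets both lengths and sums be compared. Induction on `as`: one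
-- occurrence of the head is removed from `bs`, and uniqueness keeps the tail inside what remains.
unique-⊆⇒↭ : ∀ {A : Set} {as bs : List A} → Unique as → as ⊆ bs →
             ∃[ cs ] bs ↭ as ++ cs
unique-⊆⇒↭ {as = []}     {bs} _ _ = bs , ↭-refl
unique-⊆⇒↭ {as = a ∷ as} {bs} (a∉as ∷ uas) as⊆bs with ∈-∃++ (as⊆bs (here refl))
... | ps , qs , refl with unique-⊆⇒↭ uas as⊆ps++qs
  where
  as⊆ps++qs : as ⊆ ps ++ qs
  as⊆ps++qs b∈as with ∈-resp-↭ (shift a ps qs) (as⊆bs (there b∈as))
  ... | here refl = contradiction refl (All.lookup a∉as b∈as)
  ... | there b∈  = b∈
... | cs , ps++qs↭ = cs , ↭-trans (shift a ps qs) (prep a ps++qs↭)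

unique-⊆⇒length≤ : ∀ {A : Set} {as bs : List A} → Unique as → as ⊆ bs → length as ≤ length bs
unique-⊆⇒length≤ {as = as} uas as⊆bs with unique-⊆⇒↭ uas as⊆bs
... | cs , bs↭ = ℕ.≤-trans (ℕ.m≤m+n _ _)
  (ℕ.≤-reflexive (sym (trans (↭-length bs↭) (length-++ as))))

-- Rational sums

sumℚ-++ : ∀ ps qs → sumℚ (ps ++ qs) ≡ sumℚ ps ℚ.+ sumℚ qs
sumℚ-++ []       qs = sym (ℚ.+-identityˡ _)
sumℚ-++ (p ∷ ps) qs = trans (cong (p ℚ.+_) (sumℚ-++ ps qs)) (sym (ℚ.+-assoc p _ _))

sumℚ-↭ : ∀ {ps qs} → ps ↭ qs → sumℚ ps ≡ sumℚ qs
sumℚ-↭ ps↭qs = foldr-commMonoid (setoid ℚ) ℚ.+-0-isCommutativeMonoid (↭⇒↭ₛ ps↭qs)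

module _ {A : Set} where

  sumℚ-map-mono : ∀ {f g : A → ℚ} → (∀ a → f a ℚ.≤ g a) →
                  ∀ as → sumℚ (map f as) ℚ.≤ sumℚ (map g as)
  sumℚ-map-mono f≤g []       = ℚ.≤-refl
  sumℚ-map-mono f≤g (a ∷ as) = ℚ.+-mono-≤ (f≤g a) (sumℚ-map-mono f≤g as)

  sumℚ-map-nonNeg : ∀ {f : A → ℚ} → (∀ a → 0ℚ ℚ.≤ f a) → ∀ as → 0ℚ ℚ.≤ sumℚ (map f as)
  sumℚ-map-nonNeg 0≤f []       = ℚ.≤-refl
  sumℚ-map-nonNeg 0≤f (a ∷ as) = ℚ.+-mono-≤ (0≤f a) (sumℚ-map-nonNeg 0≤f as)

  -- Up to order `bs` is `as ++ cs`, and the leftover `cs` adds a nonnegative amount.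
  sumℚ-map-⊆ : ∀ {f : A → ℚ} → (∀ a → 0ℚ ℚ.≤ f a) →
               ∀ {as bs} → Unique as → as ⊆ bs → sumℚ (map f as) ℚ.≤ sumℚ (map f bs)
  sumℚ-map-⊆ {f} 0≤f {as} {bs} uas as⊆bs with unique-⊆⇒↭ uas as⊆bs
  ... | cs , bs↭ = begin
    sumℚ (map f as)                            ≡⟨ ℚ.+-identityʳ _ ⟨
    sumℚ (map f as) ℚ.+ 0ℚ                     ≤⟨ ℚ.+-monoʳ-≤ (sumℚ (map f as)) (sumℚ-map-nonNeg 0≤f cs) ⟩
    sumℚ (map f as) ℚ.+ sumℚ (map f cs)        ≡⟨ sumℚ-++ (map f as) (map f cs) ⟨
    sumℚ (map f as ++ map f cs)                ≡⟨ cong sumℚ (map-++ f as cs) ⟨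
    sumℚ (map f (as ++ cs))                    ≡⟨ sumℚ-↭ (↭-map⁺ f bs↭) ⟨
    sumℚ (map f bs)                            ∎
    where open ℚ.≤-Reasoning

-- Transfer from unnormalised rationals

-- Fractions with variable numerators do not normalise by evaluation. Through `fromℚᵘ` their sums
-- and inequalities become integer statements.
fromℚᵘ-homo-+ : ∀ p q → fromℚᵘ p ℚ.+ fromℚᵘ q ≡ fromℚᵘ (p ℚᵘ.+ q)
fromℚᵘ-homo-+ p q = ℚ.toℚᵘ-injective (begin
  toℚᵘ (fromℚᵘ p ℚ.+ fromℚᵘ q)           ≈⟨ ℚ.toℚᵘ-homo-+ (fromℚᵘ p) (fromℚᵘ q) ⟩
  toℚᵘ (fromℚᵘ p) ℚᵘ.+ toℚᵘ (fromℚᵘ q)   ≈⟨ ℚᵘ.+-cong (ℚ.toℚᵘ-fromℚᵘ p) (ℚ.toℚᵘ-fromℚᵘ q) ⟩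
  p ℚᵘ.+ q                               ≈⟨ ℚ.toℚᵘ-fromℚᵘ (p ℚᵘ.+ q) ⟨
  toℚᵘ (fromℚᵘ (p ℚᵘ.+ q))               ∎)
  where open ℚᵘ.≃-Reasoning

fromℚᵘ-homo-neg : ∀ p → ℚ.- fromℚᵘ p ≡ fromℚᵘ (ℚᵘ.- p)
fromℚᵘ-homo-neg p = ℚ.toℚᵘ-injective (begin
  toℚᵘ (ℚ.- fromℚᵘ p)       ≈⟨ ℚ.toℚᵘ-homo‿- (fromℚᵘ p) ⟩
  ℚᵘ.- toℚᵘ (fromℚᵘ p)      ≈⟨ ℚᵘ.-‿cong (ℚ.toℚᵘ-fromℚᵘ p) ⟩
  ℚᵘ.- p                    ≈⟨ ℚ.toℚᵘ-fromℚᵘ (ℚᵘ.- p) ⟨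
  toℚᵘ (fromℚᵘ (ℚᵘ.- p))    ∎)
  where open ℚᵘ.≃-Reasoning

fromℚᵘ-mono-≤ : ∀ {p q} → p ℚᵘ.≤ q → fromℚᵘ p ℚ.≤ fromℚᵘ q
fromℚᵘ-mono-≤ {p} {q} p≤q = ℚ.toℚᵘ-cancel-≤ (begin
  toℚᵘ (fromℚᵘ p)  ≃⟨ ℚ.toℚᵘ-fromℚᵘ p ⟩
  p                ≤⟨ p≤q ⟩
  q                ≃⟨ ℚ.toℚᵘ-fromℚᵘ q ⟨
  toℚᵘ (fromℚᵘ q)  ∎)
  where open ℚᵘ.≤-Reasoning

fromℚᵘ-mono-< : ∀ {p q} → p ℚᵘ.< q → fromℚᵘ p < fromℚᵘ q
fromℚᵘ-mono-< {p} {q} p<q = ℚ.toℚᵘ-cancel-< (begin-strict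
  toℚᵘ (fromℚᵘ p)  ≃⟨ ℚ.toℚᵘ-fromℚᵘ p ⟩
  p                <⟨ p<q ⟩
  q                ≃⟨ ℚ.toℚᵘ-fromℚᵘ q ⟨
  toℚᵘ (fromℚᵘ q)  ∎)
  where open ℚᵘ.≤-Reasoning

-- `NonZero d` excludes the default value `recip 0 = 0ℚ`, which would break antitonicity.
recip-antimono : ∀ {d e} → .{{NonZero d}} → d ≤ e → recip e ℚ.≤ recip d
recip-antimono {suc d} {suc e} d≤e = fromℚᵘ-mono-≤ {mkℚᵘ (+ 1) e} {mkℚᵘ (+ 1) d}
  (*≤* (ℤ.*-monoˡ-≤-nonNeg (+ 1) (ℤ.+≤+ d≤e)))

0≤recip : ∀ d → 0ℚ ℚ.≤ recip d
0≤recip zero    = ℚ.≤-refl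
0≤recip (suc d) = fromℚᵘ-mono-≤ {mkℚᵘ (+ 0) 0} {mkℚᵘ (+ 1) d}
  (*≤* (ℤ.+≤+ z≤n))

-- Degrees and edge sums in an arbitrary graph

module _ (G : Graph) where
  open Graph G

  ∈-vertices : ∀ a → a ∈ vertices
  ∈-vertices a = subst (_∈ vertices) (Inverse.strictlyInverseˡ enum a) (∈-tabulate⁺ (index a))

  vertices-unique : Unique vertices
  vertices-unique = Unique.tabulate⁺ λ e →
    trans (sym (strictlyInverseʳ _)) (trans (cong from e) (strictlyInverseʳ _))
    where open Inverse enum

  ~⇒0<degree : ∀ {a b} → a ~ b → 0 ℕ.< degree a
  ~⇒0<degree {a} {b} a~b = ∈-length (∈-filter⁺ (a ~?_) (∈-vertices b) a~b)

  -- The neighbours, coded by the injective `f`, form a duplicate-free list inside `bs`. Codes in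
  -- `bs` may belong to no vertex.
  degree≤ : ∀ {B : Set} {f : V → B} → (∀ {b c} → f b ≡ f c → b ≡ c) →
            ∀ {a} (bs : List B) → (∀ {b} → a ~ b → f b ∈ bs) → degree a ≤ length bs
  degree≤ {f = f} f-inj {a} bs N⊆bs =
    subst (_≤ length bs) (length-map f (filter (a ~?_) vertices))
      (unique-⊆⇒length≤ (Unique.map⁺ f-inj (Unique.filter⁺ (a ~?_) vertices-unique)) ⊆bs)
    where
    ⊆bs : map f (filter (a ~?_) vertices) ⊆ bs
    ⊆bs b∈ with ∈-map⁻ f b∈
    ... | b , b∈N , refl = N⊆bs (proj₂ (∈-filter⁻ (a ~?_) {xs = vertices} b∈N))

  ∈-edges : ∀ {a b} → index a Fin.< index b → a ~ b → (a , b) ∈ edges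
  ∈-edges a<b a~b = ∈-filter⁺ _ (∈-cartesianProduct⁺ (∈-vertices _) (∈-vertices _)) (a<b , a~b)

  -- Adjacency makes both degrees positive, as `recip-antimono` requires.
  recip-degrees≥ : ∀ {a b d e} → a ~ b → degree a ≤ d → degree b ≤ e →
                   recip (d ℕ.* e) ℚ.≤ recip (degree a ℕ.* degree b)
  recip-degrees≥ {a} {b} a~b a≤d b≤e =
    recip-antimono {{ℕ.m*n≢0 (degree a) (degree b) {{ℕ.>-nonZero (~⇒0<degree a~b)}}
                                                  {{ℕ.>-nonZero (~⇒0<degree (~-sym a~b))}}}}
      (ℕ.*-mono-≤ a≤d b≤e)

  edgeTerm : V × V → ℚ
  edgeTerm (a , b) = recip (degree a ℕ.* degree b)

  sumℚ-edgeTerm≤ᵐM₂ : ∀ {es} → Unique es → es ⊆ edges → sumℚ (map edgeTerm es) ℚ.≤ ᵐM₂ G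
  sumℚ-edgeTerm≤ᵐM₂ = sumℚ-map-⊆ {f = edgeTerm} λ (a , b) → 0≤recip (degree a ℕ.* degree b)

-- Degrees and edges of T₁

degreeBound : Fin 5 → ℕ
degreeBound 0F = 1
degreeBound 1F = 2
degreeBound 2F = 4
degreeBound 3F = 2
degreeBound 4F = 1

T₁-degree≤ : ∀ {k} (a : T₁-Vertex k) → Graph.degree (T₁-graph k) a ≤ degreeBound (proj₂ a)
T₁-degree≤ {k} = bound
  where
  G = T₁-graph k
  open Graph G using (degree; _~_)

  -- Positions are taken in ℕ, where the two spine neighbours of w i have names
  -- even at the ends of the spine.
  pos : T₁-Vertex k → ℕ × Fin 5
  pos = map₁ toℕ

  pos-injective : ∀ {a b} → pos a ≡ pos b → a ≡ b
  pos-injective e = cong₂ _,_ (Fin.toℕ-injective (cong proj₁ e)) (cong proj₂ e)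

  bound : ∀ a → degree a ≤ degreeBound (proj₂ a)
  bound (u i) = degree≤ G pos-injective ((toℕ i , 1F) ∷ [])
    λ { (fwd (uv _)) → here refl }
  bound (v i) = degree≤ G pos-injective ((toℕ i , 0F) ∷ (toℕ i , 2F) ∷ [])
    λ { (bwd (uv _)) → here refl ; (fwd (vw _)) → there (here refl) }
  bound (w i) = degree≤ G pos-injective
    -- In the last block the third entry names no vertex; in the first block the fourth is `w i`
    -- itself. An upper bound tolerates both.
    ((toℕ i , 1F) ∷ (toℕ i , 3F) ∷ (suc (toℕ i) , 2F) ∷ (ℕ.pred (toℕ i) , 2F) ∷ [])
    λ { (bwd (vw _))     → here refl
      ; (fwd (wx _))     → there (here refl)
      ; (fwd (ww _ _ e)) → there (there (here (cong (_, 2F) e)))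
      ; (bwd (ww _ _ e)) → there (there (there (here (cong (λ n → ℕ.pred n , 2F) (sym e)))))
      }
  bound (x i) = degree≤ G pos-injective ((toℕ i , 2F) ∷ (toℕ i , 4F) ∷ [])
    λ { (bwd (wx _)) → here refl ; (fwd (xy _)) → there (here refl) }
  bound (y i) = degree≤ G pos-injective ((toℕ i , 3F) ∷ [])
    λ { (bwd (xy _)) → here refl }

-- The edges of the last block are left out, so that every block counted has a
-- spine edge to its successor.
edge : ∀ {m} → Fin m × Fin 5 → T₁-Vertex (suc m) × T₁-Vertex (suc m)
edge (i , 0F) = u (inject₁ i) , v (inject₁ i)
edge (i , 1F) = v (inject₁ i) , w (inject₁ i)
edge (i , 2F) = w (inject₁ i) , x (inject₁ i)
edge (i , 3F) = x (inject₁ i) , y (inject₁ i)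
edge (i , 4F) = w (inject₁ i) , w (suc i)

-- `combine i c` is the index of the vertex `(i , c)`, with value `5 * toℕ i + toℕ c`.
sameBlock : ∀ {k} (i : Fin k) {c d : Fin 5} → c Fin.< d → combine i c Fin.< combine i d
sameBlock i {c} {d} c<d rewrite Fin.toℕ-combine i c | Fin.toℕ-combine i d =
  ℕ.+-monoʳ-< (5 ℕ.* toℕ i) c<d

-- The denominators are the products of degree bounds 1·2, 2·4, 4·2, 2·1 and 4·4.
edgeWeight : Fin 5 → ℚ
edgeWeight 0F = recip 2
edgeWeight 1F = recip 8
edgeWeight 2F = recip 8
edgeWeight 3F = recip 2
edgeWeight 4F = recip 16

module _ {m : ℕ} where

  private
    G = T₁-graph (suc m)
    open Graph G using (_~_; edges; index)

  edge-injective : ∀ {p q : Fin m × Fin 5} → edge p ≡ edge q → p ≡ q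
  edge-injective {p} {q} e =
    cong₂ _,_ (Fin.inject₁-injective (cong proj₁ same)) (cong proj₂ same)
    where
    -- A left inverse of `edge` up to `inject₁`. The first endpoint determines the label, except
    -- that `wx` and `ww` edges both start at `w`, where the second endpoint decides.
    label : T₁-Vertex (suc m) × T₁-Vertex (suc m) → Fin (suc m) × Fin 5
    label ((i , 2F) , (_ , 3F)) = i , 2F
    label ((i , 2F) , _)        = i , 4F
    label ((i , c)  , _)        = i , c

    label-edge : ∀ p → label (edge p) ≡ map₁ inject₁ p
    label-edge (_ , 0F) = refl
    label-edge (_ , 1F) = refl
    label-edge (_ , 2F) = refl
    label-edge (_ , 3F) = refl
    label-edge (_ , 4F) = refl

    same : map₁ inject₁ p ≡ map₁ inject₁ q
    same = trans (sym (label-edge p)) (trans (cong label e) (label-edge q))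

  edge-~ : ∀ p → uncurry _~_ (edge p)
  edge-~ (i , 0F) = fwd (uv _)
  edge-~ (i , 1F) = fwd (vw _)
  edge-~ (i , 2F) = fwd (wx _)
  edge-~ (i , 3F) = fwd (xy _)
  edge-~ (i , 4F) = fwd (ww _ _ (cong suc (sym (Fin.toℕ-inject₁ i))))

  -- `edges` lists each edge in one orientation only; this shows that `edge` chooses that one.
  edge-increasing : ∀ p → uncurry (λ a b → index a Fin.< index b) (edge p)
  edge-increasing (i , 0F) = sameBlock (inject₁ i) z<s
  edge-increasing (i , 1F) = sameBlock (inject₁ i) (s≤s z<s)
  edge-increasing (i , 2F) = sameBlock (inject₁ i) (s≤s (s≤s z<s))
  edge-increasing (i , 3F) = sameBlock (inject₁ i) (s≤s (s≤s (s≤s z<s)))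
  edge-increasing (i , 4F) =
    Fin.combine-monoˡ-< 2F 2F (ℕ.≤-reflexive (cong suc (Fin.toℕ-inject₁ i)))

  edge-∈ : ∀ p → edge p ∈ edges
  edge-∈ p = ∈-edges G (edge-increasing p) (edge-~ p)

  degreeBounds≤ : ∀ p → let a , b = edge p in
    recip (degreeBound (proj₂ a) ℕ.* degreeBound (proj₂ b)) ℚ.≤ edgeTerm G (edge p)
  degreeBounds≤ p = let a , b = edge p in
    recip-degrees≥ G {a} {b} (edge-~ p) (T₁-degree≤ a) (T₁-degree≤ b)

  -- The split on the label lets the degree bounds evaluate, so that their product becomes the
  -- tabulated denominator.
  edgeWeight≤ : ∀ p → edgeWeight (proj₂ p) ℚ.≤ edgeTerm G (edge p)
  edgeWeight≤ p@(_ , 0F) = degreeBounds≤ p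
  edgeWeight≤ p@(_ , 1F) = degreeBounds≤ p
  edgeWeight≤ p@(_ , 2F) = degreeBounds≤ p
  edgeWeight≤ p@(_ , 3F) = degreeBounds≤ p
  edgeWeight≤ p@(_ , 4F) = degreeBounds≤ p

-- Summation over the blocks

sumℚ-edgeWeight : ∀ {A : Set} (as : List A) →
  sumℚ (map (edgeWeight ∘ proj₂) (cartesianProduct as (allFin 5))) ≡ + (21 ℕ.* length as) / 16
sumℚ-edgeWeight []       = refl
sumℚ-edgeWeight (a ∷ as) = begin
  sumℚ (map (edgeWeight ∘ proj₂) (block ++ rest))
    ≡⟨ cong sumℚ (map-++ (edgeWeight ∘ proj₂) block rest) ⟩
  sumℚ (map (edgeWeight ∘ proj₂) block ++ map (edgeWeight ∘ proj₂) rest)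
    ≡⟨ sumℚ-++ (map (edgeWeight ∘ proj₂) block) (map (edgeWeight ∘ proj₂) rest) ⟩
  -- The five labels in `block` are concrete, so their weights evaluate to 21/16.
  + 21 / 16 ℚ.+ sumℚ (map (edgeWeight ∘ proj₂) rest)
    ≡⟨ cong (+ 21 / 16 ℚ.+_) (sumℚ-edgeWeight as) ⟩
  + 21 / 16 ℚ.+ + (21 ℕ.* length as) / 16
    ≡⟨ fromℚᵘ-homo-+ (mkℚᵘ (+ 21) 15) (mkℚᵘ (+ (21 ℕ.* length as)) 15) ⟩
  fromℚᵘ (mkℚᵘ (+ 21) 15 ℚᵘ.+ mkℚᵘ (+ (21 ℕ.* length as)) 15)
    ≡⟨ ℚ.fromℚᵘ-cong {mkℚᵘ (+ 21) 15 ℚᵘ.+ mkℚᵘ (+ (21 ℕ.* length as)) 15}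
                     {mkℚᵘ (+ (21 ℕ.* suc (length as))) 15} (*≡* numerators) ⟩
  + (21 ℕ.* length (a ∷ as)) / 16
    ∎
  where
  open ≡-Reasoning
  block = map (a ,_) (allFin 5)
  rest  = cartesianProduct as (allFin 5)

  -- This is 21/16 + t/16 = (21 + t)/16 cross-multiplied; the unnormalised sum has denominator 256.
  expand : ∀ t → (+ 21 ℤ.* + 16 ℤ.+ t ℤ.* + 16) ℤ.* + 16 ≡ (+ 21 ℤ.+ t) ℤ.* + 256
  expand = solve-∀

  numerators : (+ 21 ℤ.* + 16 ℤ.+ + (21 ℕ.* length as) ℤ.* + 16) ℤ.* + 16
               ≡ + (21 ℕ.* suc (length as)) ℤ.* + 256
  numerators = trans (expand (+ (21 ℕ.* length as)))
    (cong (λ n → + n ℤ.* + 256) (sym (ℕ.*-suc 21 (length as))))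

ᵐM₂-T₁≥ : ∀ m → + (21 ℕ.* m) / 16 ℚ.≤ ᵐM₂ (T₁-graph (suc m))
ᵐM₂-T₁≥ m = begin
  + (21 ℕ.* m) / 16
    ≡⟨ cong (λ n → + (21 ℕ.* n) / 16) (length-tabulate {n = m} (λ i → i)) ⟨
  + (21 ℕ.* length (allFin m)) / 16
    ≡⟨ sumℚ-edgeWeight (allFin m) ⟨
  sumℚ (map (edgeWeight ∘ proj₂) labels)
    ≤⟨ sumℚ-map-mono edgeWeight≤ labels ⟩
  sumℚ (map (edgeTerm G ∘ edge) labels)
    ≡⟨ cong sumℚ (map-∘ labels) ⟩
  sumℚ (map (edgeTerm G) (map edge labels))
    ≤⟨ sumℚ-edgeTerm≤ᵐM₂ G edges-unique edges-⊆ ⟩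
  ᵐM₂ (T₁-graph (suc m))
    ∎
  where
  open ℚ.≤-Reasoning
  G = T₁-graph (suc m)

  labels : List (Fin m × Fin 5)
  labels = cartesianProduct (allFin m) (allFin 5)

  edges-unique : Unique (map edge labels)
  edges-unique = Unique.map⁺ edge-injective
    (Unique.cartesianProduct⁺ (Unique.allFin⁺ m) (Unique.allFin⁺ 5))

  edges-⊆ : map edge labels ⊆ Graph.edges G
  edges-⊆ e∈ with ∈-map⁻ edge e∈
  ... | p , _ , refl = edge-∈ p

-- Divergence of the lower bound

-- `mkℚᵘ` takes the denominator minus one, so this is 21m/16 - (n + 1)/4 with n = 5(m + 1).
s₅-T₁-lowerBound : ℕ → ℚᵘ
s₅-T₁-lowerBound m = mkℚᵘ (+ (21 ℕ.* m)) 15 ℚᵘ.- mkℚᵘ (+ (suc m ℕ.* 5 ℕ.+ 1)) 3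

s₅-T₁≥ : ∀ m → fromℚᵘ (s₅-T₁-lowerBound m) ℚ.≤ s₅ (T₁ (suc m))
s₅-T₁≥ m = begin
  fromℚᵘ (p ℚᵘ.- q)            ≡⟨ fromℚᵘ-homo-+ p (ℚᵘ.- q) ⟨
  fromℚᵘ p ℚ.+ fromℚᵘ (ℚᵘ.- q) ≡⟨ cong (fromℚᵘ p ℚ.+_) (fromℚᵘ-homo-neg q) ⟨
  fromℚᵘ p ℚ.- fromℚᵘ q        ≤⟨ ℚ.+-monoˡ-≤ (ℚ.- fromℚᵘ q) (ᵐM₂-T₁≥ m) ⟩
  s₅ (T₁ (suc m))              ∎
  where
  open ℚ.≤-Reasoning
  p = mkℚᵘ (+ (21 ℕ.* m)) 15
  q = mkℚᵘ (+ (suc m ℕ.* 5 ℕ.+ 1)) 3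

-- The shift 40 + 16N solves (m - 24)/16 = N + 1.
lowerBound-unbounded : ∀ N {m} → 40 ℕ.+ 16 ℕ.* N ≤ m →
                       mkℚᵘ (+ suc N) 0 ℚᵘ.≤ s₅-T₁-lowerBound m
lowerBound-unbounded N {m} K≤m = *≤* (begin
  + suc N ℤ.* + 64
    ≡⟨ expandˡ (+ N) ⟩
  -- Over the unnormalised denominator 64 = 16·4 the bound has numerator 4m - 96.
  (+ 40 ℤ.+ + 16 ℤ.* + N) ℤ.* + 4 ℤ.- + 96
    ≤⟨ ℤ.+-monoˡ-≤ (ℤ.- + 96) (ℤ.*-monoʳ-≤-nonNeg (+ 4) K≤m′) ⟩
  + m ℤ.* + 4 ℤ.- + 96
    ≡⟨ expandʳ (+ m) ⟩
  (+ 21 ℤ.* + m ℤ.* + 4 ℤ.+ ℤ.- ((+ 1 ℤ.+ + m) ℤ.* + 5 ℤ.+ + 1) ℤ.* + 16) ℤ.* + 1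
    ≡⟨ cong₂ (λ s t → (s ℤ.* + 4 ℤ.+ ℤ.- (t ℤ.+ + 1) ℤ.* + 16) ℤ.* + 1)
         (ℤ.pos-* 21 m) (ℤ.pos-* (suc m) 5) ⟨
  (+ (21 ℕ.* m) ℤ.* + 4 ℤ.+ ℤ.- + (suc m ℕ.* 5 ℕ.+ 1) ℤ.* + 16) ℤ.* + 1
    ∎)
  where
  open ℤ.≤-Reasoning

  K≤m′ : + 40 ℤ.+ + 16 ℤ.* + N ℤ.≤ + m
  K≤m′ = subst (λ t → + 40 ℤ.+ t ℤ.≤ + m) (ℤ.pos-* 16 N) (ℤ.+≤+ K≤m)

  expandˡ : ∀ a → (+ 1 ℤ.+ a) ℤ.* + 64 ≡ (+ 40 ℤ.+ + 16 ℤ.* a) ℤ.* + 4 ℤ.- + 96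
  expandˡ = solve-∀

  expandʳ : ∀ b → b ℤ.* + 4 ℤ.- + 96 ≡
    (+ 21 ℤ.* b ℤ.* + 4 ℤ.+ ℤ.- ((+ 1 ℤ.+ b) ℤ.* + 5 ℤ.+ + 1) ℤ.* + 16) ℤ.* + 1
  expandʳ = solve-∀

-- The denominator is at least 1, so a nonnegative fraction is at most its numerator; a negative one
-- lies below any positive integer.
p<1+∣↥p∣ : ∀ p → p ℚᵘ.< mkℚᵘ (+ suc ℤ.∣ ℚᵘ.↥ p ∣) 0
p<1+∣↥p∣ (mkℚᵘ (+ n)    d) = *<* (subst₂ ℤ._<_
  (sym (ℤ.*-identityʳ (+ n))) (ℤ.pos-* (suc n) (suc d))
  (ℤ.+<+ (ℕ.<-≤-trans (ℕ.n<1+n n) (ℕ.m≤m*n (suc n) (suc d)))))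
p<1+∣↥p∣ (mkℚᵘ -[1+ n ] d) = *<* ℤ.-<+

theorem1 : ∀ (M : ℚ) → ∃[ K ] (∀ (k : ℕ) → .{{_ : NonZero k}} → K ≤ k → M < s₅ (T₁ k))
-- The outer `suc` accounts for k = m + 1: the bounds are stated in m.
theorem1 M = suc (40 ℕ.+ 16 ℕ.* N) , large
  where
  open ℚ.≤-Reasoning
  N = ℤ.∣ ℚᵘ.↥ (toℚᵘ M) ∣

  large : ∀ k → .{{_ : NonZero k}} → suc (40 ℕ.+ 16 ℕ.* N) ≤ k → M < s₅ (T₁ k)
  large (suc m) (s≤s K≤m) = begin-strict
    M                                ≡⟨ ℚ.fromℚᵘ-toℚᵘ M ⟨
    fromℚᵘ (toℚᵘ M)                  <⟨ fromℚᵘ-mono-< (ℚᵘ.<-≤-trans (p<1+∣↥p∣ (toℚᵘ M)) (lowerBound-unbounded N K≤m)) ⟩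
    fromℚᵘ (s₅-T₁-lowerBound m)      ≤⟨ s₅-T₁≥ m ⟩
    s₅ (T₁ (suc m))                  ∎
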